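{- Let $w_1,w_2,\dots\in F$ be arbitrary, set $w_0=1$, and define $a_0=1,a_1,a_2,\dots$ by $\sum_{n\ge0}a_nz^n=\bigl(\sum_{n\ge0}w_nz^n\bigr)^{ -1}$. Then \[ \sum_{L}w_L\,\mathbf r_L=\Bigl(\sum_{n\ge0}a_n\mathbf h_n\Bigr)^{ -1}, \] where the sum is over all compositions $L$ (including the empty one, with $\mathbf r_\emptyset=1$) and $w_L=w_{L_1}\cdots w_{L_k}$ for $L=(L_1,\dots,L_k)$.
   Context: $F$ is a field of characteristic $0$. In $F\langle\langle X_1,X_2,\dots\rangle\rangle$ (noncommuting variables), $\mathbf h_n=\sum_{i_1\le\cdots\le i_n}X_{i_1}\cdots X_{i_n}$ ($\mathbf h_0=1$). For a composition $L=(L_1,\dots,L_k)$ of $n$, $\mathbf r_L=\sum X_{i_1}\cdots X_{i_n}$ over $(i_1,\dots,i_n)$ with $i_1\le\cdots\le i_{L_1}>i_{L_1+1}\le\cdots\le i_{L_1+L_2}>\cdots>i_{L_1+\cdots+L_{k-1}+1}\le\cdots\le i_n$. -}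

module Defs where

open import Algebra.Apartness.Bundles using (HeytingCommutativeRing; HeytingField)
open import Algebra.Bundles using (CommutativeRing)
open import Data.Bool.Base using (if_then_else_)
open import Data.Fin.Base using (toℕ)
open import Data.List.Base using (List; []; _∷_; length; lookup; map; foldr; take; drop)
open import Data.List.Membership.Propositional using (_∉_)
open import Data.List.Relation.Unary.Linked using (Linked; linked?)
open import Data.List.Relation.Unary.Unique.Propositional using (Unique)
open import Data.Nat.Base as ℕ using (ℕ; zero; suc; _∸_; NonZero)
open import Data.Nat.Properties using (_≟_; _≤?_; _>?_)
open import Data.Product.Base using (∃; _×_; _,_; proj₁; uncurry)
open import Relation.Binary.PropositionalEquality.Core using (_≡_)
open import Relation.Nullary.Decidable using (Dec; yes; no; does; map′; _×-dec_)
open import Relation.Unary using (Pred; Decidable)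

-- The letter i stands for the variable X_{i+1}, so that the word
-- i₁ ∷ … ∷ iₙ ∷ [] is the monomial X_{i₁+1} ⋯ X_{iₙ+1}.
Word : Set
Word = List ℕ

Composition : Set
Composition = List (∃ NonZero)

parts : Composition → List ℕ
parts = map proj₁

-- HasPattern L u: the letters of u satisfy
--   i₁ ≤ ⋯ ≤ i_{L₁} > i_{L₁+1} ≤ ⋯ ≤ i_{L₁+L₂} > ⋯ > i_{L₁+⋯+L_{k-1}+1} ≤ ⋯ ≤ iₙ,
-- read off from left to right; the first entry of L counts the letters
-- remaining in the current weakly increasing run.
data HasPattern : List ℕ → Word → Set where
  []   : HasPattern [] []
  [-]  : ∀ {i} → HasPattern (1 ∷ []) (i ∷ [])
  _≤∷_ : ∀ {i j l L u} → i ℕ.≤ j →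
         HasPattern (l ∷ L) (j ∷ u) → HasPattern (suc l ∷ L) (i ∷ j ∷ u)
  _>∷_ : ∀ {i j l L u} → i ℕ.> j →
         HasPattern (l ∷ L) (j ∷ u) → HasPattern (1 ∷ l ∷ L) (i ∷ j ∷ u)

hasPattern? : ∀ L u → Dec (HasPattern L u)
hasPattern? []                    []          = yes []
hasPattern? []                    (i ∷ u)     = no λ ()
hasPattern? (l ∷ L)               []          = no λ ()
hasPattern? (zero ∷ L)            (i ∷ [])    = no λ ()
hasPattern? (1 ∷ [])              (i ∷ [])    = yes [-]
hasPattern? (1 ∷ l ∷ L)           (i ∷ [])    = no λ ()
hasPattern? (suc (suc l) ∷ L)     (i ∷ [])    = no λ ()
hasPattern? (zero ∷ L)            (i ∷ j ∷ u) = no λ ()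
hasPattern? (1 ∷ [])              (i ∷ j ∷ u) = no λ { (_ ≤∷ p) → zeroHead p }
  where
  zeroHead : ∀ {L u} {A : Set} → HasPattern (zero ∷ L) u → A
  zeroHead ()
hasPattern? (1 ∷ l ∷ L)           (i ∷ j ∷ u) =
  map′ (uncurry _>∷_) (λ { (i>j >∷ p) → i>j , p })
       (i >? j ×-dec hasPattern? (l ∷ L) (j ∷ u))
hasPattern? (suc (suc l) ∷ L)     (i ∷ j ∷ u) =
  map′ (uncurry _≤∷_) (λ { (i≤j ≤∷ p) → i≤j , p })
       (i ≤? j ×-dec hasPattern? (suc l ∷ L) (j ∷ u))

module _ {c ℓ₁ ℓ₂} (F : HeytingField c ℓ₁ ℓ₂) where

  underlyingRing : CommutativeRing c ℓ₁
  underlyingRing =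
    HeytingCommutativeRing.commutativeRing (HeytingField.heytingCommutativeRing F)

  open CommutativeRing underlyingRing using (_≈_; 0#; 1#; +-monoid)
  open import Algebra.Properties.Monoid.Mult +-monoid using ()
    renaming (_×_ to _·_)

  CharacteristicZero : Set ℓ₁
  CharacteristicZero = ∀ n → n · 1# ≈ 0# → n ≡ 0

module Series {c ℓ₁ ℓ₂} (F : HeytingField c ℓ₁ ℓ₂) where

  open CommutativeRing (underlyingRing F)
    using (Carrier; _≈_; _*_; 0#; 1#; +-commutativeMonoid)
  open import Algebra.Properties.CommutativeMonoid.Sum +-commutativeMonoid
    using (sum-syntax; sum⁺-syntax)

  -- F[[z]]: a n is the coefficient of zⁿ.
  F[[z]] : Set c
  F[[z]] = ℕ → Carrier

  1ᶻ : F[[z]]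
  1ᶻ zero    = 1#
  1ᶻ (suc _) = 0#

  infixl 7 _*ᶻ_
  _*ᶻ_ : F[[z]] → F[[z]] → F[[z]]
  (a *ᶻ b) n = ∑[ k ≤ n ] (a (toℕ k) * b (n ∸ toℕ k))

  infix 4 _≈ᶻ_
  _≈ᶻ_ : F[[z]] → F[[z]] → Set ℓ₁
  a ≈ᶻ b = ∀ n → a n ≈ b n

  infix 4 _IsInverseOfᶻ_
  _IsInverseOfᶻ_ : F[[z]] → F[[z]] → Set ℓ₁
  a IsInverseOfᶻ b = a *ᶻ b ≈ᶻ 1ᶻ × b *ᶻ a ≈ᶻ 1ᶻ

  -- F⟨⟨X₁,X₂,…⟩⟩: f u is the coefficient of the monomial u.
  F⟨⟨X⟩⟩ : Set c
  F⟨⟨X⟩⟩ = Word → Carrier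

  1ˣ : F⟨⟨X⟩⟩
  1ˣ []      = 1#
  1ˣ (_ ∷ _) = 0#

  infixl 7 _*ˣ_
  _*ˣ_ : F⟨⟨X⟩⟩ → F⟨⟨X⟩⟩ → F⟨⟨X⟩⟩
  (f *ˣ g) u = ∑[ k ≤ length u ] (f (take (toℕ k) u) * g (drop (toℕ k) u))

  infixr 7 _•_
  _•_ : Carrier → F⟨⟨X⟩⟩ → F⟨⟨X⟩⟩
  (x • f) u = x * f u

  infix 4 _≈ˣ_
  _≈ˣ_ : F⟨⟨X⟩⟩ → F⟨⟨X⟩⟩ → Set ℓ₁
  f ≈ˣ g = ∀ u → f u ≈ g u

  infix 4 _IsInverseOf_
  _IsInverseOf_ : F⟨⟨X⟩⟩ → F⟨⟨X⟩⟩ → Set ℓ₁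
  f IsInverseOf g = f *ˣ g ≈ˣ 1ˣ × g *ˣ f ≈ˣ 1ˣ

  -- The possibly infinite sum of the distinct monomials satisfying P: each
  -- of them has coefficient 1, every other monomial has coefficient 0.
  ∑-monomials : ∀ {p} {P : Pred Word p} → Decidable P → F⟨⟨X⟩⟩
  ∑-monomials P? u = if does (P? u) then 1# else 0#

  𝐡 : ℕ → F⟨⟨X⟩⟩
  𝐡 n = ∑-monomials λ u → length u ≟ n ×-dec linked? _≤?_ u

  𝐫 : Composition → F⟨⟨X⟩⟩
  𝐫 L = ∑-monomials (hasPattern? (parts L))

  weight : (ℕ → Carrier) → Composition → Carrier
  weight w L = foldr (λ l x → w l * x) 1# (parts L)

  -- Sums of locally finite families: for every monomial u, only finitely
  -- many members of the family have a nonzero coefficient at u, and these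
  -- coefficients add up to s u.  When equality on I is decidable, such an s
  -- is unique up to _≈ˣ_.
  infix 4 _IsSumOf_
  _IsSumOf_ : F⟨⟨X⟩⟩ → {I : Set} → (I → F⟨⟨X⟩⟩) → Set ℓ₁
  _IsSumOf_ s {I} f = ∀ u → ∃ λ (is : List I) →
    Unique is ×
    (∀ i → i ∉ is → f i u ≈ 0#) ×
    s u ≈ ∑[ k < length is ] f (lookup is k) u

-- For an invertible power series b and a scalar ε let
--   G b ε = ∑_L ε^{ℓ(L)-1} b_L 𝐫_L ,
-- so that G w 1 is the left-hand side of the theorem and G a 0 = ∑ aₙ 𝐡ₙ.
-- If b and b′ are inverse to each other with constant term 1 and ε + ε′ = 1,
-- then G b ε and G b′ ε′ are inverse to each other; the theorem is the case
-- (ε , ε′) = (1 , 0), and the two sides of "inverse" are exchanged by symmetry.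

module Submission where

open import Defs
open import Algebra.Apartness.Bundles using (HeytingField)
open import Algebra.Bundles using (CommutativeRing)
open import Data.Bool.Base using (if_then_else_)
open import Data.Fin.Base using (Fin; toℕ)
open import Data.List.Base using ([]; _∷_; length; take; drop; foldr)
open import Data.List.Relation.Unary.All using ([])
open import Data.List.Relation.Unary.AllPairs using ([]; _∷_)
open import Data.List.Relation.Unary.Any using (here)
open import Data.List.Relation.Unary.Linked using (Linked; []; [-]; _∷_; linked?)
open import Data.Nat.Base as ℕ using (ℕ; suc)
open import Data.Nat.Properties using (_≟_; _≤?_; ≤-<-connex; <⇒≱)
open import Data.Product.Base using (∃; ∃-syntax; _×_; _,_; proj₁; proj₂)
open import Data.Sum.Base using (inj₁; inj₂)
open import Function.Base using (_∘_)
open import Relation.Binary.PropositionalEquality as ≡ using (_≡_; refl; cong)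
open import Relation.Nullary.Decidable using (Dec; does; yes; no; dec-true; dec-false; _×-dec_)
open import Relation.Nullary.Negation using (¬_; contradiction)
open import Relation.Unary using (Pred; Decidable)
import Relation.Binary.Reasoning.Setoid as ≈-Reasoning

-- Descent compositions of words.

-- Comparing neighbouring letters decides whether a run continues or ends. Hence at most one `𝐫 L`
-- is nonzero at a given word.
HasPattern-unique : ∀ {L M u} → HasPattern L u → HasPattern M u → L ≡ M
HasPattern-unique []         []          = refl
HasPattern-unique [-]        [-]         = refl
HasPattern-unique (_ ≤∷ p)   (_ ≤∷ q)    with refl ← HasPattern-unique p q = refl
HasPattern-unique (i≤j ≤∷ _) (i>j >∷ _)  = contradiction i≤j (<⇒≱ i>j)
HasPattern-unique (i>j >∷ _) (i≤j ≤∷ _)  = contradiction i≤j (<⇒≱ i>j)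
HasPattern-unique (_ >∷ p)   (_ >∷ q)    = cong (1 ∷_) (HasPattern-unique p q)

-- Matching on `suc` makes the `NonZero` proofs equal by eta, so only the numbers are compared.
parts-injective : ∀ L M → parts L ≡ parts M → L ≡ M
parts-injective []                []                 _  = refl
parts-injective ((suc l , _) ∷ L) ((suc m , _) ∷ M) eq
  -- `foldr (λ k _ → k) 0` is the head of a list, with default `0`.
  with refl ← cong (foldr (λ k _ → k) 0) eq =
  cong (_ ∷_) (parts-injective L M (cong (drop 1) eq))

-- The first part is kept apart as `suc l`: a letter put in front either lengthens that run or, at a
-- descent, turns it into an ordinary nonzero part behind a new run of length 1.
run-composition : ∀ i u →
  ∃ λ l → ∃ λ (L : Composition) → HasPattern (suc l ∷ parts L) (i ∷ u)
run-composition i []      = 0 , [] , [-]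
run-composition i (j ∷ u) with run-composition j u | ≤-<-connex i j
... | l , L , p | inj₁ i≤j = suc l , L , i≤j ≤∷ p
... | l , L , p | inj₂ i>j = 0 , (suc l , _) ∷ L , i>j >∷ p

composition : ∀ u → ∃ λ (L : Composition) → HasPattern (parts L) u
composition []      = [] , []
composition (i ∷ u) with run-composition i u
... | l , L , p = (suc l , _) ∷ L , p

module _ {c ℓ₁ ℓ₂} (F : HeytingField c ℓ₁ ℓ₂) where

  open CommutativeRing (underlyingRing F)
    renaming (refl to ≈-refl; sym to ≈-sym; trans to ≈-trans; reflexive to ≈-reflexive)
  open Series F
  open ≈-Reasoning setoid
  open import Algebra.Properties.CommutativeMonoid.Sum +-commutativeMonoid
    using (sum-cong-≋; sum-syntax; sum⁺-syntax)
  open import Algebra.Properties.Semiring.Sum semiring using (*-distribˡ-sum)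

  ∑-monomials-∈ : ∀ {p} {P : Pred Word p} (P? : Decidable P) {u} →
                  P u → ∑-monomials P? u ≡ 1#
  ∑-monomials-∈ P? {u} pu = cong (if_then 1# else 0#) (dec-true (P? u) pu)

  ∑-monomials-∉ : ∀ {p} {P : Pred Word p} (P? : Decidable P) {u} →
                  ¬ P u → ∑-monomials P? u ≡ 0#
  ∑-monomials-∉ P? {u} ¬pu = cong (if_then 1# else 0#) (dec-false (P? u) ¬pu)

  singleton-sum : ∀ {s} {I : Set} {f : I → F⟨⟨X⟩⟩} (index : Word → I) →
                  (∀ u i → ¬ i ≡ index u → f i u ≈ 0#) →
                  (∀ u → s u ≈ f (index u) u) →
                  s IsSumOf f
  singleton-sum index vanishes eq u =
    index u ∷ [] , [] ∷ [] ,
    (λ i i∉ → vanishes u i (i∉ ∘ here)) ,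
    ≈-trans (eq u) (≈-sym (+-identityʳ _))

  -- The coefficients of `G b ε`.

  module _ (b : F[[z]]) (ε : Carrier) where

    -- The coefficient at i ∷ u of G b ε, except that a first run of length
    -- k + 1 gets the weight f k instead of b (k + 1).
    R : F[[z]] → ℕ → Word → Carrier
    R f i []      = f 0
    R f i (j ∷ u) = if does (i ≤? j) then R (f ∘ suc) j u
                    else f 0 * (ε * R (b ∘ suc) j u)

    -- The empty word gets `b 0` rather than `1#`, so that the empty left and right factors of a
    -- one-run word supply the outer terms of a convolution.
    G : F⟨⟨X⟩⟩
    G []      = b 0
    G (i ∷ u) = R (b ∘ suc) i u

    R-≤ : ∀ f {i j} u → i ℕ.≤ j → R f i (j ∷ u) ≡ R (f ∘ suc) j u
    R-≤ f {i} {j} u i≤j = cong (if_then _ else _) (dec-true (i ≤? j) i≤j)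

    R-> : ∀ f {i j} u → i ℕ.> j → R f i (j ∷ u) ≡ f 0 * (ε * R (b ∘ suc) j u)
    R-> f {i} {j} u i>j = cong (if_then _ else _) (dec-false (i ≤? j) (<⇒≱ i>j))

    -- Each coefficient contains the first-run weight as a factor exactly once, all later runs being
    -- weighted by `b`.
    R-linear : ∀ x f g i u →
               x * R f i u + R g i u ≈ R (λ n → x * f n + g n) i u
    R-linear x f g i []      = ≈-refl
    R-linear x f g i (j ∷ u) with ≤-<-connex i j
    ... | inj₁ i≤j
      rewrite R-≤ f u i≤j | R-≤ g u i≤j | R-≤ (λ n → x * f n + g n) u i≤j
      = R-linear x (f ∘ suc) (g ∘ suc) j u
    ... | inj₂ i>j
      rewrite R-> f u i>j | R-> g u i>j | R-> (λ n → x * f n + g n) u i>j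
      = begin
      x * (f 0 * y) + g 0 * y ≈⟨ +-congʳ (*-assoc x (f 0) y) ⟨
      x * f 0 * y + g 0 * y   ≈⟨ distribʳ y (x * f 0) (g 0) ⟨
      (x * f 0 + g 0) * y     ∎
      where y = ε * R (b ∘ suc) j u

    R-zero : ∀ {f} → (∀ n → f n ≈ 0#) → ∀ i u → R f i u ≈ 0#
    R-zero f≈0 i []          = f≈0 0
    R-zero {f} f≈0 i (j ∷ u) with ≤-<-connex i j
    ... | inj₁ i≤j rewrite R-≤ f u i≤j = R-zero (f≈0 ∘ suc) j u
    ... | inj₂ i>j rewrite R-> f u i>j = ≈-trans (*-congʳ (f≈0 0)) (zeroˡ _)

  -- The product of `G b ε` and `G b′ ε′`.

  module _ {b b′ : F[[z]]} {ε ε′ : Carrier}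
           (b′₀≈1 : b′ 0 ≈ 1#) (b₀≈1 : b 0 ≈ 1#) (ε+ε′≈1 : ε + ε′ ≈ 1#)
           (bb′≈1 : b *ᶻ b′ ≈ᶻ 1ᶻ) where

    -- The share of the product coefficient at `i ∷ u` due to cuts after `i`, with `f` in place of
    -- `b ∘ suc`.
    R*G : F[[z]] → ℕ → Word → Carrier
    R*G f i u = ∑[ k ≤ length u ]
                  (R b ε f i (take (toℕ k) u) * G b′ ε′ (drop (toℕ k) u))

    -- The cut before `i` adds the term with `b 0`, so the first run is weighted by `b *ᶻ b′` in
    -- positive degree, which vanishes. The equation is a hypothesis so that the induction proving
    -- it can apply this lemma to shorter words.
    cancel : ∀ i u → R*G (b ∘ suc) i u ≈ R b′ ε′ ((b ∘ suc) *ᶻ b′) i u →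
             (G b ε *ˣ G b′ ε′) (i ∷ u) ≈ 0#
    cancel i u eq = begin
      b 0 * R b′ ε′ (b′ ∘ suc) i u + R*G (b ∘ suc) i u
        ≈⟨ +-congˡ eq ⟩
      b 0 * R b′ ε′ (b′ ∘ suc) i u + R b′ ε′ ((b ∘ suc) *ᶻ b′) i u
        ≈⟨ R-linear b′ ε′ (b 0) (b′ ∘ suc) ((b ∘ suc) *ᶻ b′) i u ⟩
      R b′ ε′ ((b *ᶻ b′) ∘ suc) i u
        ≈⟨ R-zero b′ ε′ (bb′≈1 ∘ suc) i u ⟩
      0# ∎

    -- Since x + y ≈ 0, only the part ε′ x of x = ε x + ε′ x survives.
    split-cancel : ∀ {x y} → b 0 * x + y ≈ 0# → x + ε * y ≈ ε′ * x
    split-cancel {x} {y} eq = begin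
      x + ε * y                 ≈⟨ +-congʳ (*-identityˡ x) ⟨
      1# * x + ε * y            ≈⟨ +-congʳ (*-congʳ (≈-trans (+-comm ε′ ε) ε+ε′≈1)) ⟨
      (ε′ + ε) * x + ε * y      ≈⟨ +-congʳ (distribʳ x ε′ ε) ⟩
      ε′ * x + ε * x + ε * y    ≈⟨ +-assoc _ _ _ ⟩
      ε′ * x + (ε * x + ε * y)  ≈⟨ +-congˡ (distribˡ ε x y) ⟨
      ε′ * x + ε * (x + y)      ≈⟨ +-congˡ (*-congˡ (+-congʳ (≈-trans (*-congʳ b₀≈1) (*-identityˡ x)))) ⟨
      ε′ * x + ε * (b 0 * x + y) ≈⟨ +-congˡ (≈-trans (*-congˡ eq) (zeroʳ ε)) ⟩
      ε′ * x + 0#               ≈⟨ +-identityʳ _ ⟩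
      ε′ * x                    ∎

    -- Moving the cut through the first run convolves its weight with `b′`. Later cuts are absorbed
    -- at the descent, since the product vanishes on the remaining word.
    R*G≈R : ∀ f i u → R*G f i u ≈ R b′ ε′ (f *ᶻ b′) i u
    R*G≈R f i []      = ≈-refl
    R*G≈R f i (j ∷ u) with ≤-<-connex i j
    ... | inj₁ i≤j = begin
      f 0 * x + ∑[ k ≤ length u ] (R b ε f i (j ∷ take (toℕ k) u) * g k)
        ≈⟨ +-congˡ (sum-cong-≋ λ k → *-congʳ {g k}
             (≈-reflexive (R-≤ b ε f (take (toℕ k) u) i≤j))) ⟩
      f 0 * x + R*G (f ∘ suc) j u
        ≈⟨ +-congˡ (R*G≈R (f ∘ suc) j u) ⟩
      f 0 * x + R b′ ε′ ((f ∘ suc) *ᶻ b′) j u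
        -- The cut right after `i` supplies the term `f 0 * b′ (suc n)` of `(f *ᶻ b′) (suc n)`.
        ≈⟨ R-linear b′ ε′ (f 0) (b′ ∘ suc) ((f ∘ suc) *ᶻ b′) j u ⟩
      R b′ ε′ ((f *ᶻ b′) ∘ suc) j u
        ≡⟨ R-≤ b′ ε′ (f *ᶻ b′) u i≤j ⟨
      R b′ ε′ (f *ᶻ b′) i (j ∷ u) ∎
      where
      x = G b′ ε′ (j ∷ u)
      g : Fin (suc (length u)) → Carrier
      g k = G b′ ε′ (drop (toℕ k) u)
    ... | inj₂ i>j = begin
      f 0 * x + ∑[ k ≤ length u ] (R b ε f i (j ∷ take (toℕ k) u) * g k)
        ≈⟨ +-congˡ (sum-cong-≋ λ k → ≈-trans
             (*-congʳ {g k} (≈-reflexive (R-> b ε f (take (toℕ k) u) i>j)))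
             (≈-trans (*-congʳ (≈-sym (*-assoc _ _ _))) (*-assoc _ _ _))) ⟩
      f 0 * x + ∑[ k ≤ length u ] (f 0 * ε * t k)
        ≈⟨ +-congˡ (*-distribˡ-sum (f 0 * ε) t) ⟨
      f 0 * x + f 0 * ε * R*G (b ∘ suc) j u
        ≈⟨ +-congˡ (*-assoc _ _ _) ⟩
      f 0 * x + f 0 * (ε * R*G (b ∘ suc) j u)
        ≈⟨ distribˡ _ _ _ ⟨
      f 0 * (x + ε * R*G (b ∘ suc) j u)
        -- The cut at the descent carries no `ε`, the later cuts carry one; together they leave the
        -- descent factor `ε′`. The factor `f 0` equals `(f *ᶻ b′) 0` because `b′ 0 ≈ 1#`.
        ≈⟨ *-cong (≈-trans (+-identityʳ _) (≈-trans (*-congˡ b′₀≈1) (*-identityʳ _)))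
             (≈-sym (split-cancel (cancel j u (R*G≈R (b ∘ suc) j u)))) ⟨
      (f *ᶻ b′) 0 * (ε′ * x)
        ≡⟨ R-> b′ ε′ (f *ᶻ b′) u i>j ⟨
      R b′ ε′ (f *ᶻ b′) i (j ∷ u) ∎
      where
      x = G b′ ε′ (j ∷ u)
      g t : Fin (suc (length u)) → Carrier
      g k = G b′ ε′ (drop (toℕ k) u)
      t k = R b ε (b ∘ suc) j (take (toℕ k) u) * g k

    G*G≈1 : G b ε *ˣ G b′ ε′ ≈ˣ 1ˣ
    G*G≈1 []      = bb′≈1 0
    G*G≈1 (i ∷ u) = cancel i u (R*G≈R (b ∘ suc) i u)

  -- `ε = 1`: the sum over compositions.

  module _ (w : F[[z]]) where

    -- Each step within the first run shifts `f`, so a run of `suc l` letters is weighted by `f l`;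
    -- a descent costs only the factor `1#`.
    R₁-pattern : ∀ f {i l L u} → HasPattern (suc l ∷ L) (i ∷ u) →
                 R w 1# f i u ≈ f l * foldr (λ l x → w l * x) 1# L
    R₁-pattern f [-] = ≈-sym (*-identityʳ _)
    R₁-pattern f {l = suc l} {u = j ∷ u} (i≤j ≤∷ p) =
      ≈-trans (≈-reflexive (R-≤ w 1# f u i≤j)) (R₁-pattern (f ∘ suc) p)
    R₁-pattern f {L = suc l ∷ L} {u = j ∷ u} (i>j >∷ p) =
      ≈-trans (≈-reflexive (R-> w 1# f u i>j))
              (*-congˡ (≈-trans (*-identityˡ _) (R₁-pattern (w ∘ suc) p)))

    G₁-pattern : w 0 ≈ 1# → ∀ L {u} → HasPattern (parts L) u → G w 1# u ≈ weight w L
    G₁-pattern w₀≈1 []                []          = w₀≈1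
    G₁-pattern w₀≈1 ((suc l , _) ∷ L) {_ ∷ _} p   = R₁-pattern (w ∘ suc) p

    G₁-isSum : w 0 ≈ 1# → G w 1# IsSumOf (λ L → weight w L • 𝐫 L)
    G₁-isSum w₀≈1 = singleton-sum (proj₁ ∘ composition)
      (λ u L L≢ → ≈-trans
        (*-congˡ (≈-reflexive (∑-monomials-∉ (hasPattern? (parts L)) λ p →
          L≢ (parts-injective L _ (HasPattern-unique p (proj₂ (composition u)))))))
        (zeroʳ _))
      (λ u → let L , p = composition u in ≈-trans
        (G₁-pattern w₀≈1 L p)
        (≈-sym (≈-trans
          (*-congˡ (≈-reflexive (∑-monomials-∈ (hasPattern? (parts L)) p)))
          (*-identityʳ _))))

  -- `ε = 0`: the sum of the `a n • 𝐡 n`.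

  module _ (a : F[[z]]) where

    R₀-linked : ∀ f {i u} → Linked ℕ._≤_ (i ∷ u) → R a 0# f i u ≡ f (length u)
    R₀-linked f [-]                    = refl
    R₀-linked f {u = j ∷ u} (i≤j ∷ lk) =
      ≡.trans (R-≤ a 0# f u i≤j) (R₀-linked (f ∘ suc) lk)

    -- The first descent brings in the factor `ε = 0#`.
    R₀-¬linked : ∀ f i u → ¬ Linked ℕ._≤_ (i ∷ u) → R a 0# f i u ≈ 0#
    R₀-¬linked f i []      ¬lk = contradiction [-] ¬lk
    R₀-¬linked f i (j ∷ u) ¬lk with ≤-<-connex i j
    ... | inj₁ i≤j = ≈-trans (≈-reflexive (R-≤ a 0# f u i≤j))
                             (R₀-¬linked (f ∘ suc) j u (¬lk ∘ (i≤j ∷_)))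
    ... | inj₂ i>j = ≈-trans (≈-reflexive (R-> a 0# f u i>j))
                             (≈-trans (*-congˡ (zeroˡ _)) (zeroʳ _))

    G₀-linked : ∀ {u} → Linked ℕ._≤_ u → G a 0# u ≡ a (length u)
    G₀-linked {[]}    _  = refl
    G₀-linked {_ ∷ _} lk = R₀-linked (a ∘ suc) lk

    G₀-¬linked : ∀ u → ¬ Linked ℕ._≤_ u → G a 0# u ≈ 0#
    G₀-¬linked []      ¬lk = contradiction [] ¬lk
    G₀-¬linked (i ∷ u) ¬lk = R₀-¬linked (a ∘ suc) i u ¬lk

    -- Only words of length `n` occur in `𝐡 n`, so `length` serves as the index, also for words with
    -- a descent, where both sides are zero.
    G₀-isSum : G a 0# IsSumOf (λ n → a n • 𝐡 n)
    G₀-isSum = singleton-sum length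
      (λ u n n≢ → ≈-trans
        (*-congˡ (≈-reflexive (∑-monomials-∉ (linkedOfLength? n) {u} (n≢ ∘ ≡.sym ∘ proj₁))))
        (zeroʳ _))
      (λ u → eq u (linked? _≤?_ u))
      where
      linkedOfLength? : ∀ n → Decidable (λ u → length u ≡ n × Linked ℕ._≤_ u)
      linkedOfLength? n u = length u ≟ n ×-dec linked? _≤?_ u

      eq : ∀ u → Dec (Linked ℕ._≤_ u) → G a 0# u ≈ a (length u) * 𝐡 (length u) u
      eq u (yes lk) = begin
        G a 0# u         ≡⟨ G₀-linked lk ⟩
        a (length u)     ≈⟨ *-identityʳ _ ⟨
        a (length u) * 1# ≡⟨ cong (a (length u) *_) (∑-monomials-∈ (linkedOfLength? _) (refl , lk)) ⟨
        a (length u) * 𝐡 (length u) u ∎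
      eq u (no ¬lk) = begin
        G a 0# u         ≈⟨ G₀-¬linked u ¬lk ⟩
        0#               ≈⟨ zeroʳ _ ⟨
        a (length u) * 0# ≡⟨ cong (a (length u) *_) (∑-monomials-∉ (linkedOfLength? _) (¬lk ∘ proj₂)) ⟨
        a (length u) * 𝐡 (length u) u ∎

  inverse-constant-term : ∀ a w → w 0 ≈ 1# → a *ᶻ w ≈ᶻ 1ᶻ → a 0 ≈ 1#
  inverse-constant-term a w w₀≈1 aw≈1 = begin
    a 0            ≈⟨ *-identityʳ _ ⟨
    a 0 * 1#       ≈⟨ *-congˡ w₀≈1 ⟨
    a 0 * w 0      ≈⟨ +-identityʳ _ ⟨
    (a *ᶻ w) 0     ≈⟨ aw≈1 0 ⟩
    1#             ∎

  G-isInverse : ∀ a w → w 0 ≈ 1# → a IsInverseOfᶻ w → G w 1# IsInverseOf G a 0#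
  G-isInverse a w w₀≈1 (aw≈1 , wa≈1) =
    G*G≈1 a₀≈1 w₀≈1 (+-identityʳ 1#) wa≈1 ,
    G*G≈1 w₀≈1 a₀≈1 (+-identityˡ 1#) aw≈1
    where a₀≈1 = inverse-constant-term a w w₀≈1 aw≈1

theorem11 :
    ∀ {c ℓ₁ ℓ₂} (F : HeytingField c ℓ₁ ℓ₂) → CharacteristicZero F →
    let open HeytingField F
        open Series F
    in
    (w a : ℕ → Carrier) →
    w 0 ≈ 1# →
    a IsInverseOfᶻ w →
    ∃[ S ] ∃[ H ]
      S IsSumOf (λ (L : Composition) → weight w L • 𝐫 L) ×
      H IsSumOf (λ (n : ℕ) → a n • 𝐡 n) ×
      S IsInverseOf H
theorem11 F _ w a w₀≈1 inv =
  G F w 1# , G F a 0# , G₁-isSum F w w₀≈1 , G₀-isSum F a , G-isInverse F a w w₀≈1 inv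
  where open HeytingField F using (0#; 1#)
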